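{- Let $p$ be a prime, $k\ge 1$, and $G=\mathbb{Z}_{p^k}$. Then: (i) there is a deterministic query algorithm that, for every finite set $X$ and every function $f:G\to X$ hiding a subgroup $H\le G$, makes exactly $2$ queries and correctly decides whether $H$ is trivial; (ii) there is a deterministic query algorithm that, for every finite set $X$ and every function $f:G\to X$ hiding a subgroup $H\le G$, outputs $H$ and makes at most $2+\log_p\frac{|G|}{|H|}$ queries, i.e. $O\!\left(1+\log\frac{|G|}{|H|}\right)$ queries.
   Context: Hidden subgroup problem ($\mathsf{HSP}$): $G$ is a finite group (known to the algorithm), $X$ a finite set, and $f:G\to X$ is an unknown function with the promise that there is a subgroup $H\le G$ such that for all $g_1,g_2\in G$, $f(g_1)=f(g_2)$ iff $g_1H=g_2H$; we say $f$ hides $H$. The identification version asks to output $H$; the decision version asks whether $H$ is the trivial group $\{e\}$. A deterministic query algorithm accesses $f$ only by adaptively choosing elements $g\in G$ and receiving $f(g)$ (a query); its query complexity on $f$ is the number of queries made. $\mathbb{Z}_{p^k}$ is the additive group of integers modulo $p^k$. -}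

module Defs where

open import Algebra.Structures using (IsGroup)
open import Data.Fin.Base using (Fin; toℕ)
open import Data.Fin.Properties using (toℕ-injective; toℕ-fromℕ<; toℕ<n; toℕ≤n)
open import Data.Fin.Subset using (Subset; _∈_; ⁅_⁆; ∣_∣)
open import Data.Fin.Subset.Properties using (p⊆q⇒∣p∣≤∣q∣; ∣⁅x⁆∣≡1; x∈⁅y⁆⇒x≡y)
open import Data.Nat.Base
  using (ℕ; suc; _+_; _∸_; _^_; _≤_; _/_; _%_; NonZero; >-nonZero; >-nonZero⁻¹)
open import Data.Nat.DivMod
  using (_mod_; m%n<n; n%n≡0; m<n⇒m%n≡m; %-distribˡ-+; m%n%n≡m%n)
open import Data.Nat.Primality using (Prime; prime⇒nonZero)
open import Data.Nat.Properties using (+-comm; +-assoc; m+[n∸m]≡n; m^n≢0)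
open import Data.Product.Base using (∃-syntax; _×_; _,_)
open import Function.Base using (_∘_)
open import Function.Bundles using (_↔_; _⇔_; Inverse)
open import Level using (0ℓ)
open import Relation.Binary.PropositionalEquality
open import Relation.Unary using (Pred; _≐_)

-- Adaptive decision trees, with questions in Q, answers in A and results in R.
data QueryAlgorithm (Q A R : Set) : Set where
  output : R → QueryAlgorithm Q A R
  query  : Q → (A → QueryAlgorithm Q A R) → QueryAlgorithm Q A R

module _ {Q A R : Set} where

  result : QueryAlgorithm Q A R → (Q → A) → R
  result (output r)     f = r
  result (query q next) f = result (next (f q)) f

  queryCount : QueryAlgorithm Q A R → (Q → A) → ℕ
  queryCount (output r)     f = 0
  queryCount (query q next) f = suc (queryCount (next (f q)) f)

record FiniteGroup (n : ℕ) : Set where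
  infixl 7 _∙_
  infix  8 _⁻¹
  field
    _∙_     : Fin n → Fin n → Fin n
    ε       : Fin n
    _⁻¹     : Fin n → Fin n
    isGroup : IsGroup _≡_ _∙_ ε _⁻¹

module _ {n : ℕ} (G : FiniteGroup n) where
  open FiniteGroup G

  record Subgroup : Set where
    field
      elements  : Subset n
      ε-closed  : ε ∈ elements
      ∙-closed  : ∀ {x y} → x ∈ elements → y ∈ elements → x ∙ y ∈ elements
      ⁻¹-closed : ∀ {x} → x ∈ elements → x ⁻¹ ∈ elements

    order : ℕ
    order = ∣ elements ∣

    order≢0 : NonZero order
    order≢0 = >-nonZero (subst (_≤ order) (∣⁅x⁆∣≡1 ε)
      (p⊆q⇒∣p∣≤∣q∣ λ x∈⁅ε⁆ → subst (_∈ elements) (sym (x∈⁅y⁆⇒x≡y ε x∈⁅ε⁆)) ε-closed))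

    -- ∣G∣ / ∣H∣; the division is exact by Lagrange's theorem.
    index : ℕ
    index = (n / order) {{order≢0}}

  open Subgroup

  IsTrivial : Subgroup → Set
  IsTrivial H = elements H ≡ ⁅ ε ⁆

  LeftCoset : Fin n → Subgroup → Pred (Fin n) 0ℓ
  LeftCoset g H x = ∃[ h ] h ∈ elements H × x ≡ g ∙ h

  Hides : {X : Set} → (Fin n → X) → Subgroup → Set
  Hides f H = ∀ g₁ g₂ → f g₁ ≡ f g₂ ⇔ LeftCoset g₁ H ≐ LeftCoset g₂ H

-- Algorithms receive elements of X as their codes in an enumeration of X, so
-- that one and the same algorithm can be run on functions into any finite set.
oracle : {n m : ℕ} {X : Set} → X ↔ Fin m → (Fin n → X) → Fin n → ℕ
oracle enum f = toℕ ∘ Inverse.to enum ∘ f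

HSPAlgorithm : ℕ → Set → Set
HSPAlgorithm n R = QueryAlgorithm (Fin n) ℕ R

module _ (n : ℕ) .{{_ : NonZero n}} where

  private
    infixl 6 _⊕_

    _⊕_ : Fin n → Fin n → Fin n
    x ⊕ y = (toℕ x + toℕ y) mod n

    𝟘 : Fin n
    𝟘 = 0 mod n

    ⊖_ : Fin n → Fin n
    ⊖ x = (n ∸ toℕ x) mod n

    toℕ-mod : ∀ a → toℕ (a mod n) ≡ a % n
    toℕ-mod a = toℕ-fromℕ< (m%n<n a n)

    mod-toℕ : ∀ x → toℕ x mod n ≡ x
    mod-toℕ x = toℕ-injective (trans (toℕ-mod (toℕ x)) (m<n⇒m%n≡m (toℕ<n x)))

    mod-cong : ∀ {a b} → a % n ≡ b % n → a mod n ≡ b mod n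
    mod-cong {a} {b} eq = toℕ-injective (trans (toℕ-mod a) (trans eq (sym (toℕ-mod b))))

    %-absorbˡ : ∀ a b → (toℕ (a mod n) + b) % n ≡ (a + b) % n
    %-absorbˡ a b = begin
      (toℕ (a mod n) + b) % n      ≡⟨ cong (λ c → (c + b) % n) (toℕ-mod a) ⟩
      (a % n + b) % n              ≡⟨ %-distribˡ-+ (a % n) b n ⟩
      (a % n % n + b % n) % n      ≡⟨ cong (λ c → (c + b % n) % n) (m%n%n≡m%n a n) ⟩
      (a % n + b % n) % n          ≡⟨ %-distribˡ-+ a b n ⟨
      (a + b) % n                  ∎
      where open ≡-Reasoning

    %-absorbʳ : ∀ a b → (a + toℕ (b mod n)) % n ≡ (a + b) % n
    %-absorbʳ a b = begin
      (a + toℕ (b mod n)) % n      ≡⟨ cong (_% n) (+-comm a _) ⟩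
      (toℕ (b mod n) + a) % n      ≡⟨ %-absorbˡ b a ⟩
      (b + a) % n                  ≡⟨ cong (_% n) (+-comm b a) ⟩
      (a + b) % n                  ∎
      where open ≡-Reasoning

    ⊕-comm : ∀ x y → x ⊕ y ≡ y ⊕ x
    ⊕-comm x y = cong (_mod n) (+-comm (toℕ x) (toℕ y))

    ⊕-assoc : ∀ x y z → (x ⊕ y) ⊕ z ≡ x ⊕ (y ⊕ z)
    ⊕-assoc x y z = mod-cong (begin
      (toℕ (x ⊕ y) + toℕ z) % n        ≡⟨ %-absorbˡ (toℕ x + toℕ y) (toℕ z) ⟩
      (toℕ x + toℕ y + toℕ z) % n      ≡⟨ cong (_% n) (+-assoc (toℕ x) (toℕ y) (toℕ z)) ⟩
      (toℕ x + (toℕ y + toℕ z)) % n    ≡⟨ %-absorbʳ (toℕ x) (toℕ y + toℕ z) ⟨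
      (toℕ x + toℕ (y ⊕ z)) % n        ∎)
      where open ≡-Reasoning

    ⊕-identityˡ : ∀ x → 𝟘 ⊕ x ≡ x
    ⊕-identityˡ x = trans (mod-cong (%-absorbˡ 0 (toℕ x))) (mod-toℕ x)

    ⊕-inverseʳ : ∀ x → x ⊕ (⊖ x) ≡ 𝟘
    ⊕-inverseʳ x = mod-cong (begin
      (toℕ x + toℕ (⊖ x)) % n      ≡⟨ %-absorbʳ (toℕ x) (n ∸ toℕ x) ⟩
      (toℕ x + (n ∸ toℕ x)) % n    ≡⟨ cong (_% n) (m+[n∸m]≡n (toℕ≤n x)) ⟩
      n % n                        ≡⟨ n%n≡0 n ⟩
      0                            ≡⟨ m<n⇒m%n≡m (>-nonZero⁻¹ n) ⟨
      0 % n                        ∎)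
      where open ≡-Reasoning

  ℤ/ : FiniteGroup n
  ℤ/ = record
    { _∙_     = _⊕_
    ; ε       = 𝟘
    ; _⁻¹     = ⊖_
    ; isGroup = record
      { isMonoid = record
        { isSemigroup = record
          { isMagma = record { isEquivalence = isEquivalence ; ∙-cong = cong₂ _⊕_ }
          ; assoc   = ⊕-assoc
          }
        ; identity = ⊕-identityˡ , λ x → trans (⊕-comm x 𝟘) (⊕-identityˡ x)
        }
      ; inverse = (λ x → trans (⊕-comm (⊖ x) x) (⊕-inverseʳ x)) , ⊕-inverseʳ
      ; ⁻¹-cong = cong ⊖_
      }
    }

ℤ/p^ : ∀ {p} → Prime p → (k : ℕ) → FiniteGroup (p ^ k)
ℤ/p^ {p} p-prime k = ℤ/ (p ^ k) {{m^n≢0 p k {{prime⇒nonZero p-prime}}}}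

{-# OPTIONS --safe #-}

-- The subgroups of ℤ/pᵏ form a chain: H consists of the multiples of pʲ, where
-- j is least with pʲ ∈ H.  A point x lies in H iff f(x) = f(0), so after the
-- query of 0 one further query of pᵏ⁻¹, which generates the smallest nontrivial
-- subgroup, decides triviality, and querying 1, p, p², … until the answer f(0)
-- returns finds j with at most j + 1 further queries, where pʲ = |G|/|H|.  No
-- query is needed to recognise j = k.

module Submission where

open import Defs
open import Algebra.Structures using (IsGroup)
open import Data.Bool.Base using (Bool; true; false; not; if_then_else_)
open import Data.Fin.Base using (Fin; toℕ)
open import Data.Fin.Properties using (toℕ-injective; toℕ-fromℕ<; fromℕ<-cong; toℕ<n)
open import Data.Fin.Subset using (Subset; _∈_; _∉_; _⊆_; ⁅_⁆; ∣_∣; Empty)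
open import Data.Fin.Subset.Properties
  using (⊆-antisym; Empty-unique; ∣⊥∣≡0; x∈⁅y⁆⇒x≡y; x∈⁅x⁆)
open import Data.Nat.Base
open import Data.Nat.Coprimality using (Coprime; coprime-divisor)
open import Data.Nat.Divisibility
open import Data.Nat.DivMod
  using (_mod_; m%n<n; n%n≡0; m*n%n≡0; m<n⇒m%n≡m; [m+kn]%n≡m%n; %-distribˡ-+; m*n/n≡m)
open import Data.Nat.GCD using (gcd; gcd[m,n]∣m; gcd[m,n]∣n; gcd-GCD; module Bézout)
open import Data.Nat.Logarithm using (⌊log₂_⌋; ⌊log₂⌋-mono-≤; ⌊log₂[2^n]⌋≡n)
open import Data.Nat.Primality
  using (Prime; prime⇒nonZero; prime⇒nonTrivial; prime⇒irreducible)
open import Data.Nat.Properties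
open import Data.Product.Base using (∃-syntax; Σ-syntax; _×_; _,_)
open import Data.Sum.Base using (inj₁; inj₂)
open import Data.Vec.Base using (tabulate)
open import Data.Vec.Properties using (lookup⇒[]=; []=⇒lookup; lookup∘tabulate; tabulate-cong)
open import Function.Base using (_∘_)
open import Function.Bundles using (_↔_; _⇔_; mk⇔; Equivalence; Injection; Inverse)
open import Function.Properties.Inverse using (↔⇒↣)
open import Relation.Binary.PropositionalEquality
open import Relation.Nullary using (Dec; yes; no; does; contradiction)
open import Relation.Nullary.Decidable using (dec-true; dec-false)
open import Relation.Unary using (_≐_)
open Equivalence using (to; from)
open Subgroup

-- Prime powers: divisors and logarithms.

coprime-to-prime : ∀ {p d} → Prime p → p ∤ d → Coprime d p
coprime-to-prime p-prime p∤d (i∣d , i∣p) with prime⇒irreducible p-prime i∣p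
... | inj₁ i≡1  = i≡1
... | inj₂ refl = contradiction i∣d p∤d

-- Induction on `k`: if `p` divides `d`, one factor `p` cancels; otherwise `d` is coprime to `p` and
-- already divides the next lower power.
divisor-of-prime-power : ∀ {p d} → Prime p → ∀ k → d ∣ p ^ k → ∃[ i ] d ≡ p ^ i
divisor-of-prime-power p-prime zero d∣1 = 0 , ∣1⇒≡1 d∣1
divisor-of-prime-power {p} {d} p-prime (suc k) d∣p^1+k with p ∣? d
... | no p∤d = divisor-of-prime-power p-prime k
                 (coprime-divisor (coprime-to-prime p-prime p∤d) d∣p^1+k)
... | yes (divides-refl q) =
  let i , q≡p^i = divisor-of-prime-power p-prime k
        (*-cancelˡ-∣ p {{prime⇒nonZero p-prime}} (subst (_∣ p ^ suc k) (*-comm q p) d∣p^1+k))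
  in suc i , trans (*-comm q p) (cong (p *_) q≡p^i)

^-monoʳ-∣ : ∀ p {i j} → i ≤ j → p ^ i ∣ p ^ j
^-monoʳ-∣ p {i} {j} i≤j = subst (p ^ i ∣_)
  (trans (sym (^-distribˡ-+-* p i (j ∸ i))) (cong (p ^_) (m+[n∸m]≡n i≤j))) (m∣m*n _)

-- Turns a bound in the exponent of `p` into one in the binary logarithm, whose constant is then
-- independent of `p`.
≤-⌊log₂^⌋ : ∀ {p} → 2 ≤ p → ∀ l → l ≤ ⌊log₂ p ^ l ⌋
≤-⌊log₂^⌋ {p} 2≤p l = begin
  l              ≡⟨ ⌊log₂[2^n]⌋≡n l ⟨
  ⌊log₂ 2 ^ l ⌋  ≤⟨ ⌊log₂⌋-mono-≤ (^-monoˡ-≤ l 2≤p) ⟩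
  ⌊log₂ p ^ l ⌋  ∎
  where open ≤-Reasoning

-- Counting the multiples of d below n.

does-true⁻¹ : ∀ {A : Set} (A? : Dec A) → does A? ≡ true → A
does-true⁻¹ (yes a) _ = a

-- The predicate lives on ℕ rather than on `Fin n`, so that it can be shifted when the range is
-- split into blocks.
_selectedFrom_ : (ℕ → Bool) → (n : ℕ) → Subset n
b selectedFrom n = tabulate (b ∘ toℕ)

∈-selectedFrom : ∀ {n} b {x : Fin n} → x ∈ b selectedFrom n ⇔ b (toℕ x) ≡ true
∈-selectedFrom b {x} = mk⇔
  (λ x∈ → trans (sym (lookup∘tabulate (b ∘ toℕ) x)) ([]=⇒lookup x∈))
  (λ eq → lookup⇒[]= x _ (trans (lookup∘tabulate (b ∘ toℕ) x) eq))

∣selectedFrom-+∣ : ∀ b m n →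
  ∣ b selectedFrom (m + n) ∣ ≡ ∣ b selectedFrom m ∣ + ∣ (b ∘ (m +_)) selectedFrom n ∣
∣selectedFrom-+∣ b zero    n = refl
∣selectedFrom-+∣ b (suc m) n with b 0
... | true  = cong suc (∣selectedFrom-+∣ (b ∘ suc) m n)
... | false = ∣selectedFrom-+∣ (b ∘ suc) m n

multiples : (n d : ℕ) → Subset n
multiples n d = (λ a → does (d ∣? a)) selectedFrom n

∈-multiples : ∀ {n d} {x : Fin n} → x ∈ multiples n d ⇔ d ∣ toℕ x
∈-multiples {d = d} {x} = mk⇔
  (λ x∈ → does-true⁻¹ (d ∣? toℕ x) (to (∈-selectedFrom (λ a → does (d ∣? a))) x∈))
  (λ d∣x → from (∈-selectedFrom (λ a → does (d ∣? a))) (dec-true (d ∣? toℕ x) d∣x))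

∣multiples-period∣ : ∀ d .{{_ : NonZero d}} → ∣ multiples d d ∣ ≡ 1
∣multiples-period∣ d@(suc d-1) rewrite dec-true (d ∣? 0) (d ∣0) =
  cong suc (trans (cong ∣_∣ (Empty-unique none)) (∣⊥∣≡0 d-1))
  where
  none : Empty ((λ a → does (d ∣? suc a)) selectedFrom d-1)
  none (x , x∈) = >⇒∤ (s<s (toℕ<n x))
    (does-true⁻¹ (d ∣? suc (toℕ x)) (to (∈-selectedFrom (λ a → does (d ∣? suc a))) x∈))

-- Each block of `d` consecutive numbers contributes one multiple: the first block contains only 0,
-- and divisibility by `d` is invariant under a shift by `d`.
∣multiples∣ : ∀ q d .{{_ : NonZero d}} → ∣ multiples (q * d) d ∣ ≡ q
∣multiples∣ zero    d = refl
∣multiples∣ (suc q) d = begin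
  ∣ multiples (d + q * d) d ∣
    ≡⟨ ∣selectedFrom-+∣ (λ a → does (d ∣? a)) d (q * d) ⟩
  ∣ multiples d d ∣ + ∣ (λ a → does (d ∣? (d + a))) selectedFrom (q * d) ∣
    ≡⟨ cong₂ _+_ (∣multiples-period∣ d)
         (cong ∣_∣ (tabulate-cong {n = q * d} (λ x → shift (toℕ x)))) ⟩
  1 + ∣ multiples (q * d) d ∣
    ≡⟨ cong suc (∣multiples∣ q d) ⟩
  suc q
    ∎
  where
  open ≡-Reasoning
  shift : ∀ a → does (d ∣? (d + a)) ≡ does (d ∣? a)
  shift a with d ∣? a
  ... | yes d∣a = dec-true  (d ∣? (d + a)) (∣m∣n⇒∣m+n ∣-refl d∣a)
  ... | no  d∤a = dec-false (d ∣? (d + a)) (λ d∣d+a → d∤a (∣m+n∣m⇒∣n d∣d+a ∣-refl))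

-- Cosets and the hiding promise.

module _ {n : ℕ} (G : FiniteGroup n) where
  open FiniteGroup G
  open IsGroup isGroup using (assoc; identityˡ; identityʳ; inverseʳ)

  εH≐xH⇔x∈H : ∀ (H : Subgroup G) x → LeftCoset G ε H ≐ LeftCoset G x H ⇔ x ∈ elements H
  εH≐xH⇔x∈H H x = mk⇔ only-if if
    where
    only-if : LeftCoset G ε H ≐ LeftCoset G x H → x ∈ elements H
    -- The point `x ≡ x ∙ ε` of xH must lie in εH, which is H.
    only-if (_ , xH⊆εH) with xH⊆εH (ε , ε-closed H , sym (identityʳ x))
    ... | h , h∈H , x≡εh = subst (_∈ elements H) (sym (trans x≡εh (identityˡ h))) h∈H
    if : x ∈ elements H → LeftCoset G ε H ≐ LeftCoset G x H
    if x∈H =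
      (λ { {y} (h , h∈H , y≡εh) → x ⁻¹ ∙ h , ∙-closed H (⁻¹-closed H x∈H) h∈H ,
           (begin
             y               ≡⟨ y≡εh ⟩
             ε ∙ h           ≡⟨ cong (_∙ h) (inverseʳ x) ⟨
             x ∙ x ⁻¹ ∙ h    ≡⟨ assoc x (x ⁻¹) h ⟩
             x ∙ (x ⁻¹ ∙ h)  ∎) }) ,
      (λ { (h , h∈H , y≡xh) → x ∙ h , ∙-closed H x∈H h∈H , trans y≡xh (sym (identityˡ _)) })
      where open ≡-Reasoning

  -- The promise in the form of a membership test for H. Comparing codes is as good as comparing
  -- values, since the enumeration is injective.
  oracle-agrees-with-ε : ∀ {X : Set} {m} (enum : X ↔ Fin m) {f : Fin n → X} (H : Subgroup G) →
    Hides G f H → ∀ x → oracle enum f ε ≡ oracle enum f x ⇔ x ∈ elements H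
  oracle-agrees-with-ε enum H hides x = mk⇔
    (λ eq → to (εH≐xH⇔x∈H H x)
      (to (hides ε x) (Injection.injective (↔⇒↣ enum) (toℕ-injective eq))))
    (λ x∈H → cong (toℕ ∘ Inverse.to enum)
      (from (hides ε x) (from (εH≐xH⇔x∈H H x) x∈H)))

-- Subgroups of ℤ/n: closure under multiples and gcd with n.

module _ {n : ℕ} .{{_ : NonZero n}} where

  mod-cong : ∀ {a b} → a % n ≡ b % n → a mod n ≡ b mod n
  mod-cong eq = fromℕ<-cong _ _ eq _ _

  toℕ-mod : ∀ a → toℕ (a mod n) ≡ a % n
  toℕ-mod a = toℕ-fromℕ< (m%n<n a n)

  mod-toℕ : ∀ (x : Fin n) → toℕ x mod n ≡ x
  mod-toℕ x = toℕ-injective (trans (toℕ-mod (toℕ x)) (m<n⇒m%n≡m (toℕ<n x)))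

  n∣toℕ⇒≡ε : ∀ {x : Fin n} → n ∣ toℕ x → x ≡ FiniteGroup.ε (ℤ/ n)
  n∣toℕ⇒≡ε {x} n∣x = trans (sym (mod-toℕ x))
    (mod-cong (trans (n∣m⇒m%n≡0 (toℕ x) n n∣x) (sym (m*n%n≡0 0 n))))

  module _ (H : Subgroup (ℤ/ n)) where

    mod-∈-+ : ∀ {a b} → a mod n ∈ elements H → b mod n ∈ elements H → (a + b) mod n ∈ elements H
    mod-∈-+ {a} {b} a∈H b∈H = subst (_∈ elements H) (mod-cong (begin
      (toℕ (a mod n) + toℕ (b mod n)) % n  ≡⟨ cong₂ (λ r s → (r + s) % n) (toℕ-mod a) (toℕ-mod b) ⟩
      (a % n + b % n) % n                  ≡⟨ %-distribˡ-+ a b n ⟨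
      (a + b) % n                          ∎)) (∙-closed H a∈H b∈H)
      where open ≡-Reasoning

    mod-∈-* : ∀ m {a} → a mod n ∈ elements H → (m * a) mod n ∈ elements H
    mod-∈-* zero    a∈H = ε-closed H
    mod-∈-* (suc m) a∈H = mod-∈-+ a∈H (mod-∈-* m a∈H)

    mod-∈-∣ : ∀ {a b} → a ∣ b → a mod n ∈ elements H → b mod n ∈ elements H
    mod-∈-∣ (divides-refl q) = mod-∈-* q

    n-mod-∈ : n mod n ∈ elements H
    n-mod-∈ = subst (_∈ elements H) (mod-cong (trans (m*n%n≡0 0 n) (sym (n%n≡0 n)))) (ε-closed H)

    -- In the second case multiplication by pred n plays the role of negation mod n.
    gcd-mod-∈ : ∀ {a} → a mod n ∈ elements H → gcd a n mod n ∈ elements H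
    gcd-mod-∈ {a} a∈H with Bézout.identity (gcd-GCD a n)
    ... | Bézout.+- x y eq = subst (_∈ elements H)
            (mod-cong (trans (cong (_% n) (sym eq)) ([m+kn]%n≡m%n (gcd a n) y n)))
            (mod-∈-* x a∈H)
    ... | Bézout.-+ x y eq = subst (_∈ elements H) (mod-cong (begin
            (y * n + pred n * (x * a)) % n              ≡⟨ cong (λ c → (c + pred n * (x * a)) % n) eq ⟨
            (gcd a n + x * a + pred n * (x * a)) % n    ≡⟨ cong (_% n) (+-assoc (gcd a n) _ _) ⟩
            (gcd a n + suc (pred n) * (x * a)) % n      ≡⟨ cong (λ c → (gcd a n + c * (x * a)) % n) (suc-pred n) ⟩
            (gcd a n + n * (x * a)) % n                 ≡⟨ cong (λ c → (gcd a n + c) % n) (*-comm n (x * a)) ⟩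
            (gcd a n + x * a * n) % n                   ≡⟨ [m+kn]%n≡m%n (gcd a n) (x * a) n ⟩
            gcd a n % n                                 ∎))
            (mod-∈-+ (mod-∈-* y n-mod-∈) (mod-∈-* (pred n) (mod-∈-* x a∈H)))
      where open ≡-Reasoning

-- Subgroups of ℤ/pᵏ and their indices.

module _ {p : ℕ} (p-prime : Prime p) (k : ℕ) where

  private
    instance
      p≢0 : NonZero p
      p≢0 = prime⇒nonZero p-prime
      p^k≢0 : NonZero (p ^ k)
      p^k≢0 = m^n≢0 p k

    n = p ^ k
    G = ℤ/p^ p-prime k
    ε = FiniteGroup.ε G

    [p^_] : ℕ → Fin n
    [p^ j ] = (p ^ j) mod n

    2≤p : 2 ≤ p
    2≤p = nonTrivial⇒n>1 p {{prime⇒nonTrivial p-prime}}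

  -- gcd(x, pᵏ) is a power of p lying in H, hence higher than every power of p outside H.
  p^j∉H⇒p^1+j∣ : ∀ (H : Subgroup G) j {x} → [p^ j ] ∉ elements H → x ∈ elements H → p ^ suc j ∣ toℕ x
  p^j∉H⇒p^1+j∣ H j {x} p^j∉H x∈H with divisor-of-prime-power p-prime k (gcd[m,n]∣n (toℕ x) n)
  ... | i , gcd≡p^i = ∣-trans (^-monoʳ-∣ p j<i) (subst (_∣ toℕ x) gcd≡p^i (gcd[m,n]∣m (toℕ x) n))
    where
    p^i∈H : [p^ i ] ∈ elements H
    p^i∈H = subst (λ d → d mod n ∈ elements H) gcd≡p^i
      (gcd-mod-∈ H (subst (_∈ elements H) (sym (mod-toℕ x)) x∈H))
    j<i : j < i
    j<i = ≰⇒> λ i≤j → p^j∉H (mod-∈-∣ H (^-monoʳ-∣ p i≤j) p^i∈H)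

  elements≡multiples : ∀ (H : Subgroup G) j → [p^ j ] ∈ elements H →
    (∀ {x} → x ∈ elements H → p ^ j ∣ toℕ x) → elements H ≡ multiples n (p ^ j)
  elements≡multiples H j p^j∈H p^j∣H = ⊆-antisym
    (λ x∈H → from ∈-multiples (p^j∣H x∈H))
    (λ {x} x∈ → subst (_∈ elements H) (mod-toℕ x) (mod-∈-∣ H (to ∈-multiples x∈) p^j∈H))

  -- Counting multiples gives H the order `p ^ (k ∸ j)`. This ties the exponent at which the search
  -- stops to the index in the query bound.
  index-multiples : ∀ (H : Subgroup G) j → j ≤ k → elements H ≡ multiples n (p ^ j) →
    p ^ j ≡ index H
  index-multiples H j j≤k H≡multiples = begin
    p ^ j                            ≡⟨ m*n/n≡m (p ^ j) (order H) {{order≢0 H}} ⟨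
    ((p ^ j * order H) / order H) {{order≢0 H}}
      ≡⟨ cong (λ m → (m / order H) {{order≢0 H}}) p^j*order≡n ⟩
    index H                          ∎
    where
    open ≡-Reasoning
    instance
      p^j≢0 : NonZero (p ^ j)
      p^j≢0 = m^n≢0 p j
    n≡p^[k∸j]*p^j : n ≡ p ^ (k ∸ j) * p ^ j
    n≡p^[k∸j]*p^j = trans (cong (p ^_) (sym (m∸n+n≡m j≤k))) (^-distribˡ-+-* p (k ∸ j) j)
    order≡p^[k∸j] : order H ≡ p ^ (k ∸ j)
    order≡p^[k∸j] = begin
      ∣ elements H ∣                              ≡⟨ cong ∣_∣ H≡multiples ⟩
      ∣ multiples n (p ^ j) ∣                     ≡⟨ cong (λ m → ∣ multiples m (p ^ j) ∣) n≡p^[k∸j]*p^j ⟩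
      ∣ multiples (p ^ (k ∸ j) * p ^ j) (p ^ j) ∣ ≡⟨ ∣multiples∣ (p ^ (k ∸ j)) (p ^ j) ⟩
      p ^ (k ∸ j)                                 ∎
    p^j*order≡n : p ^ j * order H ≡ n
    p^j*order≡n = trans (*-comm (p ^ j) (order H))
      (trans (cong (_* p ^ j) order≡p^[k∸j]) (sym n≡p^[k∸j]*p^j))

  -- Deciding triviality with two queries.

  decide : HSPAlgorithm n Bool
  decide = query ε λ a → query [p^ pred k ] λ b → output (not (does (a ≟ b)))

  decide-correct : 1 ≤ k → ∀ {X : Set} {m} (enum : X ↔ Fin m) {f} (H : Subgroup G) → Hides G f H →
    result decide (oracle enum f) ≡ true ⇔ IsTrivial G H
  decide-correct 1≤k enum {f} H hides with oracle enum f ε ≟ oracle enum f [p^ pred k ]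
  ... | yes same rewrite dec-true (oracle enum f ε ≟ oracle enum f [p^ pred k ]) same =
        -- The algorithm answers `false` here, so H must be shown nontrivial: it contains the
        -- residue of `p ^ pred k`, which is nonzero because 0 < pᵏ⁻¹ < pᵏ.
        mk⇔ (λ ()) λ trivial → contradiction
          (begin-strict
            0                   <⟨ m^n>0 p (pred k) ⟩
            p ^ pred k          ≡⟨ m<n⇒m%n≡m (^-monoʳ-< p 2≤p pred-k<k) ⟨
            p ^ pred k % n      ≡⟨ toℕ-mod (p ^ pred k) ⟨
            toℕ [p^ pred k ]    ≡⟨ cong toℕ (x∈⁅y⁆⇒x≡y ε (subst ([p^ pred k ] ∈_) trivial p^[k-1]∈H)) ⟩
            toℕ ε               ≡⟨ toℕ-mod 0 ⟩
            0 % n               ≡⟨ m*n%n≡0 0 n ⟩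
            0                   ∎)
          n≮0
    where
    open ≤-Reasoning
    p^[k-1]∈H : [p^ pred k ] ∈ elements H
    p^[k-1]∈H = to (oracle-agrees-with-ε G enum H hides [p^ pred k ]) same
    pred-k<k : pred k < k
    pred-k<k = ≤-reflexive (suc-pred k {{>-nonZero 1≤k}})
  ... | no differ rewrite dec-false (oracle enum f ε ≟ oracle enum f [p^ pred k ]) differ =
        mk⇔ (λ _ → ⊆-antisym H⊆⁅ε⁆ ⁅ε⁆⊆H) (λ _ → refl)
    where
    -- Since pᵏ⁻¹ is outside H, divisibility rises to the full modulus, which leaves only `ε`.
    p^k∣ : ∀ {x} → x ∈ elements H → n ∣ toℕ x
    p^k∣ {x} x∈H = subst (λ i → p ^ i ∣ toℕ x) (suc-pred k {{>-nonZero 1≤k}})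
      (p^j∉H⇒p^1+j∣ H (pred k) (differ ∘ from (oracle-agrees-with-ε G enum H hides [p^ pred k ])) x∈H)
    H⊆⁅ε⁆ : elements H ⊆ ⁅ ε ⁆
    H⊆⁅ε⁆ x∈H = subst (_∈ ⁅ ε ⁆) (sym (n∣toℕ⇒≡ε (p^k∣ x∈H))) (x∈⁅x⁆ ε)
    ⁅ε⁆⊆H : ⁅ ε ⁆ ⊆ elements H
    ⁅ε⁆⊆H x∈⁅ε⁆ = subst (_∈ elements H) (sym (x∈⁅y⁆⇒x≡y ε x∈⁅ε⁆)) (ε-closed H)

  -- Identifying H by a search through the powers of p.

  searchFrom : (j fuel : ℕ) (base : ℕ) → HSPAlgorithm n (Subset n)
  -- Starting from `identify`, `j + fuel` stays equal to `k`, so this clause is reached only at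
  -- `j = k`.
  searchFrom j zero       base = output (multiples n (p ^ j))
  searchFrom j (suc fuel) base = query [p^ j ] λ a →
    if does (base ≟ a) then output (multiples n (p ^ j)) else searchFrom (suc j) fuel base

  identify : HSPAlgorithm n (Subset n)
  identify = query ε (searchFrom 0 k)

  -- The invariant is that `p ^ j` divides every element of H. The summand `j` accounts for the
  -- failed queries of lower powers, so the total is unchanged by a recursive call.
  searchFrom-correct : ∀ {X : Set} {m} (enum : X ↔ Fin m) {f} (H : Subgroup G) → Hides G f H →
    ∀ j fuel → j + fuel ≡ k → (∀ {x} → x ∈ elements H → p ^ j ∣ toℕ x) →
    let alg = searchFrom j fuel (oracle enum f ε) in
    result alg (oracle enum f) ≡ elements H ×
    (∃[ l ] p ^ l ≡ index H × j + queryCount alg (oracle enum f) ≤ suc l)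
  searchFrom-correct enum H hides j zero j+0≡k p^j∣H with trans (sym (+-identityʳ j)) j+0≡k
  ... | refl =
    -- Here pʲ = pᵏ is congruent to 0 and lies in every subgroup; the bound has one query to spare.
    sym H≡multiples , j , index-multiples H j ≤-refl H≡multiples ,
    ≤-trans (≤-reflexive (+-identityʳ j)) (n≤1+n j)
    where
    H≡multiples = elements≡multiples H j (n-mod-∈ H) p^j∣H
  searchFrom-correct enum {f} H hides j (suc fuel) j+1+fuel≡k p^j∣H
    with oracle enum f ε ≟ oracle enum f [p^ j ]
  ... | yes same rewrite dec-true (oracle enum f ε ≟ oracle enum f [p^ j ]) same =
    sym H≡multiples , j , index-multiples H j j≤k H≡multiples , ≤-reflexive (+-comm j 1)
    where
    j≤k : j ≤ k
    j≤k = subst (j ≤_) j+1+fuel≡k (m≤m+n j (suc fuel))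
    H≡multiples = elements≡multiples H j (to (oracle-agrees-with-ε G enum H hides [p^ j ]) same) p^j∣H
  ... | no differ rewrite dec-false (oracle enum f ε ≟ oracle enum f [p^ j ]) differ =
    -- A differing answer puts pʲ outside H, which raises the invariant from `j` to `suc j`.
    let correct , l , p^l≡index , count≤ = searchFrom-correct enum H hides (suc j) fuel
          (trans (sym (+-suc j fuel)) j+1+fuel≡k)
          (p^j∉H⇒p^1+j∣ H j (differ ∘ from (oracle-agrees-with-ε G enum H hides [p^ j ])))
    in correct , l , p^l≡index , subst (_≤ suc l) (sym (+-suc j _)) count≤

  identify-correct : ∀ {X : Set} {m} (enum : X ↔ Fin m) {f} (H : Subgroup G) → Hides G f H →
    result identify (oracle enum f) ≡ elements H ×
    (∃[ l ] p ^ l ≡ index H × queryCount identify (oracle enum f) ≤ 2 + l) ×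
    queryCount identify (oracle enum f) ≤ 2 * (1 + ⌊log₂ index H ⌋)
  identify-correct enum {f} H hides
    -- The invariant starts with `p ^ 0`, which is 1. The query of `ε` adds one to `suc l`.
    with searchFrom-correct enum {f} H hides 0 k refl (λ _ → 1∣ _)
  ... | correct , l , p^l≡index , count≤ = correct , (l , p^l≡index , s≤s count≤) , (begin
    queryCount identify (oracle enum f)  ≤⟨ s≤s count≤ ⟩
    2 + l                                ≤⟨ +-monoʳ-≤ 2 (m≤n*m l 2) ⟩
    2 + 2 * l                            ≡⟨ *-suc 2 l ⟨
    2 * (1 + l)                          ≤⟨ *-monoʳ-≤ 2 (s≤s (≤-⌊log₂^⌋ 2≤p l)) ⟩
    2 * (1 + ⌊log₂ p ^ l ⌋)              ≡⟨ cong (λ i → 2 * (1 + ⌊log₂ i ⌋)) p^l≡index ⟩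
    2 * (1 + ⌊log₂ index H ⌋)            ∎)
    where open ≤-Reasoning

theorem1 : ∃[ C ] ∀ (p k : ℕ) (p-prime : Prime p) → 1 ≤ k →
    let G = ℤ/p^ p-prime k in
    (Σ[ alg ∈ HSPAlgorithm (p ^ k) Bool ]
    ∀ (X : Set) (m : ℕ) (enum : X ↔ Fin m) (f : Fin (p ^ k) → X) (H : Subgroup G) →
    Hides G f H →
    queryCount alg (oracle enum f) ≡ 2 ×
    (result alg (oracle enum f) ≡ true ⇔ IsTrivial G H))
    ×
    (Σ[ alg ∈ HSPAlgorithm (p ^ k) (Subset (p ^ k)) ]
    ∀ (X : Set) (m : ℕ) (enum : X ↔ Fin m) (f : Fin (p ^ k) → X) (H : Subgroup G) →
    Hides G f H →
    result alg (oracle enum f) ≡ Subgroup.elements H ×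
    (∃[ l ] p ^ l ≡ Subgroup.index H × queryCount alg (oracle enum f) ≤ 2 + l) ×
    queryCount alg (oracle enum f) ≤ C * (1 + ⌊log₂ Subgroup.index H ⌋))
-- The constant 2 absorbs the additive 2 uniformly in `p` and `k`. The exact query count of `decide`
-- holds by computation, since its shape does not depend on the answers.
theorem1 = 2 , λ p k p-prime 1≤k →
  (decide p-prime k , λ X m enum f H hides → refl , decide-correct p-prime k 1≤k enum H hides) ,
  (identify p-prime k , λ X m enum f H hides → identify-correct p-prime k enum H hides)
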